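{- Let $n$ be a positive integer and let $a_1, \dots, a_n$ be nonzero integers. Suppose there is a prime $p$ such that, for all $1 \le i, j \le n$, $O_p(a_i) \equiv O_p(a_j) \pmod n$ implies $i = j$. Then the equation $a_1 x_1 + \cdots + a_n x_n = 0$ is not $n$-regular.
   Context: $\mathbb{N}$ denotes the set of positive integers. For a positive integer $r$, an $r$-coloring of the positive integers is any function $C : \mathbb{N} \to \{1, \dots, r\}$. A linear homogeneous equation in $n$ variables is an equation $a_1 x_1 + \cdots + a_n x_n = 0$ with all $a_i \in \mathbb{Z} \setminus \{0\}$. It is called $r$-regular if for every $r$-coloring $C$ of the positive integers there is a monochromatic solution, i.e. positive integers $x_1, \dots, x_n$ (not necessarily distinct) satisfying the equation with $C(x_1) = \cdots = C(x_n)$. For a prime $p$ and a nonzero integer $x$, $O_p(x)$ denotes the $p$-adic order of $x$, i.e. the largest integer $v \ge 0$ such that $p^v \mid x$. -}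

module Defs where

open import Data.Fin.Base using (Fin)
open import Data.Integer.Base as ℤ using (ℤ; +_; 0ℤ; ∣_∣)
import Data.Integer.Divisibility as ℤ
import Data.Integer.Properties as ℤ
open import Data.List.Base using (filter; upTo)
open import Data.List.Extrema.Nat using (max; xs≤max; argmax-all)
open import Data.List.Membership.Propositional.Properties
  using (∈-filter⁺; ∈-upTo⁺)
open import Data.List.Relation.Unary.All using (lookup)
open import Data.List.Relation.Unary.All.Properties using (all-filter)
open import Data.Nat.Base
open import Data.Nat.Divisibility using (_∣_; _∣?_; 1∣_; ∣⇒≤)
open import Data.Nat.Primality using (Prime; prime⇒nonTrivial)
open import Data.Nat.Properties using (^-monoʳ-<; m≤n⇒m≤1+n; ≤-<-trans; <-≤-trans; n<1+n)
open import Data.Product.Base using (_×_; _,_; ∃-syntax)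
open import Data.Refinement.Base using (Refinement-syntax; value)
open import Data.Vec.Functional using (Vector)
open import Algebra.Properties.CommutativeMonoid.Sum ℤ.+-0-commutativeMonoid using (sum)
open import Function.Base using (id)
open import Relation.Binary.PropositionalEquality.Core using (_≡_; _≢_)

ℕ⁺ : Set
ℕ⁺ = [ m ∈ ℕ ∣ NonZero m ]

Coloring : ℕ → Set
Coloring r = ℕ⁺ → Fin r

-- The equation a₁x₁ + ⋯ + aₙxₙ = 0 is represented by its coefficients a.
IsSolution : ∀ {n} → Vector ℤ n → Vector ℕ⁺ n → Set
IsSolution a x = sum (λ i → a i ℤ.* + value (x i)) ≡ 0ℤ

Monochromatic : ∀ {r n} → Coloring r → Vector ℕ⁺ n → Set
Monochromatic C x = ∀ i j → C (x i) ≡ C (x j)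

Regular : ∀ {n} → ℕ → Vector ℤ n → Set
Regular r a = ∀ (C : Coloring r) → ∃[ x ] IsSolution a x × Monochromatic C x

infix 4 _≡_[mod_]

_≡_[mod_] : ℕ → ℕ → ℕ → Set
u ≡ v [mod n ] = n ∣ ∣ u - v ∣

-- The largest v with pᵛ ∣ x. Searching v ≤ ∣ x ∣ suffices, because
-- v < pᵛ ≤ ∣ x ∣ whenever p > 1, x ≠ 0 and pᵛ ∣ x; see ord-divides and
-- ord-largest. The value is not meaningful for x = 0 or p ≤ 1.
ord : ℕ → ℤ → ℕ
ord p x = max 0 (filter (λ v → p ^ v ∣? ∣ x ∣) (upTo (suc ∣ x ∣)))

ord-divides : ∀ p x → + (p ^ ord p x) ℤ.∣ x
ord-divides p x =
  argmax-all id {P = λ v → p ^ v ∣ ∣ x ∣} {⊥ = 0} (1∣ ∣ x ∣)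
    (all-filter (λ v → p ^ v ∣? ∣ x ∣) (upTo (suc ∣ x ∣)))

n<p^n : ∀ {p} → 1 < p → ∀ n → n < p ^ n
n<p^n         1<p zero    = s≤s z≤n
n<p^n {p = p} 1<p (suc n) = ≤-<-trans (n<p^n 1<p n) (^-monoʳ-< p 1<p (n<1+n n))

ord-largest : ∀ {p x} → Prime p → x ≢ 0ℤ → ∀ v → + (p ^ v) ℤ.∣ x → v ≤ ord p x
ord-largest {p} {x} p-prime x≢0 v pᵛ∣x =
  lookup (xs≤max 0 _) (∈-filter⁺ (λ v → p ^ v ∣? ∣ x ∣) (∈-upTo⁺ v<1+∣x∣) pᵛ∣x)
  where
  1<p : 1 < p
  1<p = nonTrivial⇒n>1 p {{prime⇒nonTrivial p-prime}}

  v<1+∣x∣ : v < suc ∣ x ∣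
  v<1+∣x∣ = <-≤-trans (n<p^n 1<p v) (m≤n⇒m≤1+n (∣⇒≤ {{ℤ.≢-nonZero x≢0}} pᵛ∣x))

{-# OPTIONS --safe #-}

-- Colour x by O_p(x) mod n. In a monochromatic solution the orders
-- O_p(aᵢxᵢ) = O_p(aᵢ) + O_p(xᵢ) are pairwise incongruent mod n, hence distinct,
-- and a sum of integers of distinct finite orders has the least of these orders;
-- in particular it is nonzero.

module Submission where

open import Defs
open import Data.Integer.Base using (ℤ; 0ℤ)
open import Data.Nat.Base using (ℕ; NonZero)
open import Data.Nat.Primality using (Prime)
open import Data.Product.Base using (_×_; ∃-syntax)
open import Data.Vec.Functional using (Vector)
open import Relation.Binary.PropositionalEquality.Core using (_≡_; _≢_)
open import Relation.Nullary.Negation.Core using (¬_)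

import Data.Integer.Base as ℤ
import Data.Integer.Properties as ℤ
open import Algebra.Properties.CommutativeMonoid.Sum ℤ.+-0-commutativeMonoid using (sum)
import Data.Integer.Divisibility.Signed as Signed
open import Data.Fin.Base using (zero; suc; toℕ)
open import Data.Fin.Properties using (suc-injective; toℕ-fromℕ<)
open import Data.Nat.Base using (zero; suc; _+_; _*_; _^_; _<_; _≤_; ∣_-_∣)
open import Data.Nat.Divisibility
open import Data.Nat.DivMod using (_/_; _%_; _mod_; m≡m%n+[m/n]*n; m%n<n)
open import Data.Nat.Primality using (prime⇒nonZero; euclidsLemma)
open import Data.Nat.Properties hiding (suc-injective)
open import Data.Product.Base using (_,_; proj₁; proj₂)
open import Data.Refinement.Base using (value) renaming (_,_ to _,ᵣ_)
open import Data.Sum.Base using (inj₁; inj₂)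
open import Function.Base using (_∘_)
open import Function.Definitions using (Injective)
open import Relation.Binary.Definitions using (tri<; tri≈; tri>)
open import Relation.Binary.PropositionalEquality
  using (refl; sym; trans; cong; cong₂; subst; module ≡-Reasoning)
open import Relation.Nullary.Negation.Core using (contradiction)

^-monoʳ-∣ : ∀ p {v w} → v ≤ w → p ^ v ∣ p ^ w
^-monoʳ-∣ p {v} v≤w with o , refl ← m≤n⇒∃[o]m+o≡n v≤w =
  subst (p ^ v ∣_) (sym (^-distribˡ-+-* p v o)) (m∣m*n (p ^ o))

%-≡⇒≡[mod] : ∀ u v n .{{_ : NonZero n}} → u % n ≡ v % n → u ≡ v [mod n ]
%-≡⇒≡[mod] u v n eq = divides ∣ u / n - v / n ∣ (begin
  ∣ u - v ∣
    ≡⟨ cong₂ ∣_-_∣ (m≡m%n+[m/n]*n u n)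
         (trans (m≡m%n+[m/n]*n v n) (cong (_+ v / n * n) (sym eq))) ⟩
  ∣ u % n + u / n * n - u % n + v / n * n ∣
    ≡⟨ ∣m+n-m+o∣≡∣n-o∣ (u % n) (u / n * n) (v / n * n) ⟩
  ∣ u / n * n - v / n * n ∣
    ≡⟨ *-distribʳ-∣-∣ n (u / n) (v / n) ⟨
  ∣ u / n - v / n ∣ * n ∎)
  where open ≡-Reasoning

-- Serves to move a congruence mod `n` between coefficients and variables: if two terms have equal
-- order, the orders of their coefficients differ by exactly as much as those of their variables.
m+n≡o+q⇒∣m-o∣≡∣q-n∣ : ∀ m n o q → m + n ≡ o + q → ∣ m - o ∣ ≡ ∣ q - n ∣
m+n≡o+q⇒∣m-o∣≡∣q-n∣ m n o q eq = begin
  ∣ m - o ∣         ≡⟨ ∣m+n-m+o∣≡∣n-o∣ n m o ⟨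
  ∣ n + m - n + o ∣ ≡⟨ cong₂ ∣_-_∣ (trans (+-comm n m) eq) (+-comm n o) ⟩
  ∣ o + q - o + n ∣ ≡⟨ ∣m+n-m+o∣≡∣n-o∣ o q n ⟩
  ∣ q - n ∣         ∎
  where open ≡-Reasoning

infix 4 _^_∥_

-- Exact divisibility, stated as a relation rather than as an equation `ord p z ≡ v`: it fails for
-- every `v` when `z` is 0, where `ord` still returns a number.
record _^_∥_ (p v : ℕ) (z : ℤ) : Set where
  constructor _,_
  field
    divisible  : p ^ v ∣ ℤ.∣ z ∣
    ¬divisible : ¬ p ^ suc v ∣ ℤ.∣ z ∣

∥-ord : ∀ {p z} → Prime p → z ≢ 0ℤ → p ^ ord p z ∥ z
∥-ord {p} {z} p-prime z≢0 =
  ord-divides p z , λ p∣z → 1+n≰n (ord-largest p-prime z≢0 (suc (ord p z)) p∣z)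

∥⇒≢0 : ∀ {p v z} → p ^ v ∥ z → z ≢ 0ℤ
∥⇒≢0 {p} {v} (_ , p∤z) refl = p∤z ((p ^ suc v) ∣0)

-- Up to sign `y` is `q * p ^ v` and `z` is `r * p ^ w`, with `p` dividing neither `q` nor `r`; by
-- Euclid's lemma it does not divide `q * r` either.
∥-* : ∀ {p v w y z} → Prime p → p ^ v ∥ y → p ^ w ∥ z → p ^ (v + w) ∥ y ℤ.* z
∥-* {p} {v} {w} {y} {z} p-prime (divides q y≡ , p∤y) (divides r z≡ , p∤z) =
  divides (q * r) yz≡ , p∤yz
  where
  instance
    _ = prime⇒nonZero p-prime
    _ = m^n≢0 p (v + w)

  yz≡ : ℤ.∣ y ℤ.* z ∣ ≡ q * r * p ^ (v + w)
  yz≡ = begin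
    ℤ.∣ y ℤ.* z ∣             ≡⟨ ℤ.abs-* y z ⟩
    ℤ.∣ y ∣ * ℤ.∣ z ∣         ≡⟨ cong₂ _*_ y≡ z≡ ⟩
    (q * p ^ v) * (r * p ^ w) ≡⟨ [m*n]*[o*p]≡[m*o]*[n*p] q (p ^ v) r (p ^ w) ⟩
    (q * r) * (p ^ v * p ^ w) ≡⟨ cong (q * r *_) (^-distribˡ-+-* p v w) ⟨
    q * r * p ^ (v + w)       ∎
    where open ≡-Reasoning

  p∤yz : ¬ p ^ suc (v + w) ∣ ℤ.∣ y ℤ.* z ∣
  p∤yz d with euclidsLemma q r p-prime
                (*-cancelʳ-∣ (p ^ (v + w)) (subst (p ^ suc (v + w) ∣_) yz≡ d))
  ... | inj₁ p∣q = p∤y (subst (p ^ suc v ∣_) (sym y≡) (*-monoˡ-∣ (p ^ v) p∣q))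
  ... | inj₂ p∣r = p∤z (subst (p ^ suc w ∣_) (sym z≡) (*-monoˡ-∣ (p ^ w) p∣r))

-- Since `v < w`, both `p ^ v` and `p ^ suc v` divide `z`, so each of them divides `y ℤ.+ z` exactly
-- when it divides `y`.
∥-+ : ∀ {p v w y z} → v < w → p ^ v ∥ y → p ^ w ∥ z → p ^ v ∥ y ℤ.+ z
∥-+ {p} {v} {w} {y} {z} v<w (pᵛ∣y , p∤y) (pʷ∣z , _) =
  Signed.∣⇒∣ᵤ (Signed.∣m∣n⇒∣m+n {m = y} (Signed.∣ᵤ⇒∣ pᵛ∣y) (p^∣z (<⇒≤ v<w))) ,
  λ d → p∤y (Signed.∣⇒∣ᵤ (Signed.∣m+n∣n⇒∣m {m = y} (Signed.∣ᵤ⇒∣ d) (p^∣z v<w)))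
  where
  p^∣z : ∀ {u} → u ≤ w → ℤ.+ (p ^ u) Signed.∣ z
  p^∣z u≤w = Signed.∣ᵤ⇒∣ (∣-trans (^-monoʳ-∣ p u≤w) pʷ∣z)

-- Induction on the length: the tail sum has the order of one of its own terms, which by injectivity
-- differs from the order of the head, so the smaller of the two survives in the total.
∥-sum : ∀ {p n} (t : Vector ℤ (suc n)) (v : Vector ℕ (suc n)) →
  (∀ i → p ^ v i ∥ t i) → Injective _≡_ _≡_ v → ∃[ k ] p ^ v k ∥ sum t
∥-sum {p} {zero} t v v∥t _ =
  zero , subst (p ^ v zero ∥_) (sym (ℤ.+-identityʳ (t zero))) (v∥t zero)
∥-sum {p} {suc n} t v v∥t v-inj
  with k , v∥s ← ∥-sum (t ∘ suc) (v ∘ suc) (v∥t ∘ suc) (suc-injective ∘ v-inj)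
  with <-cmp (v zero) (v (suc k))
... | tri< v₀<vₖ _ _ = zero , ∥-+ v₀<vₖ (v∥t zero) v∥s
... | tri≈ _ v₀≡vₖ _ = contradiction (v-inj v₀≡vₖ) λ ()
... | tri> _ _ vₖ<v₀ = suc k ,
  subst (p ^ v (suc k) ∥_) (ℤ.+-comm (sum (t ∘ suc)) (t zero)) (∥-+ vₖ<v₀ v∥s (v∥t zero))

+value≢0 : (x : ℕ⁺) → ℤ.+ value x ≢ 0ℤ
+value≢0 (suc _ ,ᵣ _) ()

ordColoring : ∀ p n .{{_ : NonZero n}} → Coloring n
ordColoring p n x = ord p (ℤ.+ value x) mod n

ordColoring-≡⇒≡[mod] : ∀ p n .{{_ : NonZero n}} x y →
  ordColoring p n x ≡ ordColoring p n y → ord p (ℤ.+ value x) ≡ ord p (ℤ.+ value y) [mod n ]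
ordColoring-≡⇒≡[mod] p n x y eq = %-≡⇒≡[mod] _ _ n (begin
  ord p (ℤ.+ value x) % n   ≡⟨ toℕ-fromℕ< (m%n<n _ n) ⟨
  toℕ (ordColoring p n x)   ≡⟨ cong toℕ eq ⟩
  toℕ (ordColoring p n y)   ≡⟨ toℕ-fromℕ< (m%n<n _ n) ⟩
  ord p (ℤ.+ value y) % n   ∎)
  where open ≡-Reasoning

theorem3p1 : ∀ (n : ℕ) .{{_ : NonZero n}} (a : Vector ℤ n) → (∀ i → a i ≢ 0ℤ) →
    (∃[ p ] Prime p × (∀ i j → ord p (a i) ≡ ord p (a j) [mod n ] → i ≡ j)) →
    ¬ Regular n a
-- Matching on `suc` provides the first term that `∥-sum` requires; an empty sum would be 0.
theorem3p1 n@(suc _) a a≢0 (p , p-prime , a-inj) regular =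
  ∥⇒≢0 (proj₂ (∥-sum terms orders orders∥terms orders-injective)) solution
  where
  x : Vector ℕ⁺ n
  x = proj₁ (regular (ordColoring p n))

  solution : IsSolution a x
  solution = proj₁ (proj₂ (regular (ordColoring p n)))

  mono : Monochromatic (ordColoring p n) x
  mono = proj₂ (proj₂ (regular (ordColoring p n)))

  terms : Vector ℤ n
  terms i = a i ℤ.* ℤ.+ value (x i)

  orders : Vector ℕ n
  orders i = ord p (a i) + ord p (ℤ.+ value (x i))

  orders∥terms : ∀ i → p ^ orders i ∥ terms i
  orders∥terms i = ∥-* {y = a i} p-prime (∥-ord p-prime (a≢0 i)) (∥-ord p-prime (+value≢0 (x i)))

  orders-injective : Injective _≡_ _≡_ orders
  orders-injective {i} {j} eq = a-inj i j
    (subst (n ∣_) (sym (m+n≡o+q⇒∣m-o∣≡∣q-n∣ (ord p (a i)) _ (ord p (a j)) _ eq))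
      -- The indices appear as `j`, `i` because the rearranged difference is the order of `x j`
      -- against that of `x i`.
      (ordColoring-≡⇒≡[mod] p n (x j) (x i) (mono j i)))
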